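{- For all sufficiently large $n$, the proportion of quasigroups among magmas with $n$ elements is less than $n/n!$. That is, there is $N$ such that for all $n\ge N$, the number of binary operations on $\{1,\dots,n\}$ that are quasigroup operations, divided by the number of all binary operations on $\{1,\dots,n\}$, is less than $n/n!$.
   Context: A magma is a set with a binary operation. A finite quasigroup is a magma whose Cayley table is a Latin square, i.e. every element occurs exactly once in each row and each column of the table. Magmas with $n$ elements are counted as binary operations on the fixed set $\{1,\dots,n\}$ (equivalently, as Cayley tables). -}

module Defs where

open import Algebra.Core using (Op₂)
open import Data.Fin.Base using (Fin)
open import Data.Fin.Properties using (_≟_; any?; all?)
open import Data.Integer.Base using (+_)
open import Data.List.Base using (List; []; _∷_; [_]; length; filter; allFin; cartesianProductWith)
open import Data.List.Membership.Propositional using (_∈_)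
open import Data.List.Membership.Propositional.Properties using (∈-allFin; ∈-cartesianProductWith⁺)
open import Data.List.Relation.Unary.All using ([])
open import Data.List.Relation.Unary.AllPairs using ([]; _∷_)
open import Data.List.Relation.Unary.Any using (here; there)
open import Data.List.Relation.Unary.Unique.Propositional using (Unique)
open import Data.List.Relation.Unary.Unique.Propositional.Properties using (allFin⁺; cartesianProductWith⁺)
open import Data.Nat.Base using (ℕ; zero; suc; NonZero)
open import Data.Product using (_×_; _,_; ∃!)
open import Data.Rational.Base using (ℚ; _/_)
open import Data.Vec.Base using (Vec; []; _∷_; lookup; tabulate)
open import Data.Vec.Properties using (∷-injective)
open import Relation.Binary.PropositionalEquality using (_≡_; refl)
open import Relation.Nullary.Decidable using (Dec; map′; _×-dec_; _→-dec_)
open import Relation.Unary using (Decidable)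

-- Binary operations on Fin n are counted through their Cayley tables, since
-- functions Fin n → Fin n → Fin n have no extensional _≡_ here. The entry in
-- row x and column y is the product x ∙ y.
Table : ℕ → Set
Table n = Vec (Vec (Fin n) n) n

operation : ∀ {n} → Table n → Op₂ (Fin n)
operation t x y = lookup (lookup t x) y

IsLatinSquare : ∀ {n} → Op₂ (Fin n) → Set
IsLatinSquare _∙_ =
  (∀ x z → ∃! _≡_ λ y → x ∙ y ≡ z) ×
  (∀ y z → ∃! _≡_ λ x → x ∙ y ≡ z)

IsQuasigroup : ∀ {n} → Table n → Set
IsQuasigroup t = IsLatinSquare (operation t)

∃!? : ∀ {n} {P : Fin n → Set} → Decidable P → Dec (∃! _≡_ P)
∃!? P? = map′
  (λ (x , px , uniq) → x , px , λ {y} → uniq y)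
  (λ (x , px , uniq) → x , px , λ y → uniq {y})
  (any? λ x → P? x ×-dec all? λ y → P? y →-dec (x ≟ y))

isQuasigroup? : ∀ {n} → Decidable (IsQuasigroup {n})
isQuasigroup? t =
  (all? λ x → all? λ z → ∃!? λ y → operation t x y ≟ z) ×-dec
  (all? λ y → all? λ z → ∃!? λ x → operation t x y ≟ z)

vectors : ∀ {A : Set} → List A → ∀ k → List (Vec A k)
vectors xs zero    = [ [] ]
vectors xs (suc k) = cartesianProductWith _∷_ xs (vectors xs k)

tables : ∀ n → List (Table n)
tables n = vectors (vectors (allFin n) n) n

-- The two facts tables-complete and tables-unique below say that every table
-- is listed exactly once, so that lengths of (filtered) lists are cardinalities.

vectors-complete : ∀ {A : Set} {xs : List A} → (∀ x → x ∈ xs) →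
                   ∀ {k} (v : Vec A k) → v ∈ vectors xs k
vectors-complete all∈ []      = here refl
vectors-complete all∈ (x ∷ v) =
  ∈-cartesianProductWith⁺ _∷_ (all∈ x) (vectors-complete all∈ v)

vectors-unique : ∀ {A : Set} {xs : List A} → Unique xs → ∀ k → Unique (vectors xs k)
vectors-unique xs! zero    = [] ∷ []
vectors-unique xs! (suc k) =
  cartesianProductWith⁺ _∷_ ∷-injective xs! (vectors-unique xs! k)

tables-complete : ∀ {n} (t : Table n) → t ∈ tables n
tables-complete = vectors-complete (vectors-complete ∈-allFin)

tables-unique : ∀ n → Unique (tables n)
tables-unique n = vectors-unique (vectors-unique (allFin⁺ n) n) n

#magmas : ℕ → ℕ
#magmas n = length (tables n)

#quasigroups : ℕ → ℕ
#quasigroups n = length (filter isQuasigroup? (tables n))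

nonEmpty : ∀ {A : Set} {x : A} {xs : List A} → x ∈ xs → NonZero (length xs)
nonEmpty (here _)  = _
nonEmpty (there _) = _

#magmas≢0 : ∀ n → NonZero (#magmas n)
#magmas≢0 n = nonEmpty (tables-complete {n} (tabulate λ x → tabulate λ _ → x))

quasigroupProportion : ℕ → ℚ
quasigroupProportion n = (+ #quasigroups n / #magmas n) {{#magmas≢0 n}}

-- A quasigroup table is determined by its rows other than the first, since
-- every column takes every value exactly once. Hence there are at most
-- n^(n² - n) quasigroups, and as n! ≤ n^n the product of their number with n!
-- is at most n^(n²), which is less than n · n^(n²) once n ≥ 2.

{-# OPTIONS --safe #-}
module Submission where

open import Defs
open import Data.Nat.Base using (ℕ; _≤_; _!)
open import Data.Nat.Properties using (_!≢0)
open import Data.Integer.Base using (+_)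
open import Data.Product.Base using (∃)
open import Data.Rational.Base using (_<_; _/_)

open import Data.Fin.Base using (Fin; zero; suc)
open import Data.Fin.Properties using (injective⇒≤)
import Data.Integer.Base as ℤ
import Data.Integer.Properties as ℤ
open import Data.List.Base using (List; []; _∷_; length; lookup; filter; map; allFin; cartesianProductWith)
open import Data.List.Membership.Propositional using (_∈_)
open import Data.List.Membership.Propositional.Properties using (∈-allFin; ∈-lookup; ∈-filter⁻)
open import Data.List.Properties using (length-++; length-map; length-tabulate)
open import Data.List.Relation.Unary.All using () renaming (lookup to All-lookup)
open import Data.List.Relation.Unary.AllPairs using (_∷_)
open import Data.List.Relation.Unary.Any using (index)
open import Data.List.Relation.Unary.Any.Properties using (lookup-index)
open import Data.List.Relation.Unary.Unique.Propositional using (Unique)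
open import Data.List.Relation.Unary.Unique.Propositional.Properties using (filter⁺)
open import Data.Nat.Base as ℕ using (zero; suc; _*_; _^_; NonZero)
open import Data.Nat.Properties
  using (≤-refl; ≤-trans; ≤-reflexive; n≤1+n; *-mono-≤; *-monoʳ-≤; *-comm; ^-monoˡ-≤; m<m*n; module ≤-Reasoning)
open import Data.Product.Base using (_,_; proj₂)
open import Data.Rational.Properties using (toℚᵘ-cancel-<; toℚᵘ-fromℚᵘ)
open import Data.Rational.Unnormalised.Base using (mkℚᵘ; *<*)
open import Data.Rational.Unnormalised.Properties using (<-respˡ-≃; <-respʳ-≃; ≃-sym)
open import Data.Vec.Base as Vec using (Vec; []; _∷_; tail)
open import Data.Vec.Relation.Binary.Pointwise.Extensional using (ext; Pointwise-≡⇒≡)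
open import Relation.Binary.PropositionalEquality
  using (_≡_; refl; sym; trans; cong; cong₂; subst₂; module ≡-Reasoning)
open import Relation.Nullary.Negation using (contradiction)
open import Relation.Unary using (Decidable)

module _ {A : Set} where

  lookup-injective : ∀ {xs : List A} → Unique xs → ∀ {i j} → lookup xs i ≡ lookup xs j → i ≡ j
  lookup-injective (x∉ ∷ xs!) {zero}  {zero}  eq = refl
  lookup-injective (x∉ ∷ xs!) {zero}  {suc j} eq = contradiction eq (All-lookup x∉ (∈-lookup j))
  lookup-injective (x∉ ∷ xs!) {suc i} {zero}  eq = contradiction (sym eq) (All-lookup x∉ (∈-lookup i))
  lookup-injective (x∉ ∷ xs!) {suc i} {suc j} eq = cong suc (lookup-injective xs! eq)

  -- Pigeonhole on indices: each index of `xs` goes to the place in `ys` where the image of its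
  -- entry is found. Reading `ys` at that place recovers the image, so `injective⇒≤` applies.
  injectiveOn⇒length≤ : ∀ {B : Set} (f : A → B) {xs ys} → Unique xs →
    (∀ {x y} → x ∈ xs → y ∈ xs → f x ≡ f y → x ≡ y) →
    (∀ {x} → x ∈ xs → f x ∈ ys) → length xs ≤ length ys
  injectiveOn⇒length≤ f {xs} {ys} xs! f-inj f∈ys = injective⇒≤ {f = position} position-injective
    where
    position : Fin (length xs) → Fin (length ys)
    position i = index (f∈ys (∈-lookup i))

    position-injective : ∀ {i j} → position i ≡ position j → i ≡ j
    position-injective {i} {j} eq =
      lookup-injective xs! (f-inj (∈-lookup i) (∈-lookup j) (begin
        f (lookup xs i)         ≡⟨ lookup-index (f∈ys (∈-lookup i)) ⟩
        lookup ys (position i)  ≡⟨ cong (lookup ys) eq ⟩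
        lookup ys (position j)  ≡⟨ lookup-index (f∈ys (∈-lookup j)) ⟨
        f (lookup xs j)         ∎))
      where open ≡-Reasoning

  -- Injectivity is asked only where `P` holds, because dropping the first row loses information
  -- about a general table.
  length-filter-injective : ∀ {B : Set} {P : A → Set} (P? : Decidable P) (f : A → B) {xs} → Unique xs →
    (∀ {x y} → P x → P y → f x ≡ f y → x ≡ y) →
    ∀ {ys} → (∀ y → y ∈ ys) → length (filter P? xs) ≤ length ys
  length-filter-injective P? f {xs} xs! f-inj all∈ys =
    injectiveOn⇒length≤ f (filter⁺ P? xs!)
      (λ x∈ y∈ → f-inj (proj₂ (∈-filter⁻ P? {xs = xs} x∈)) (proj₂ (∈-filter⁻ P? {xs = xs} y∈)))
      (λ _ → all∈ys _)

length-cartesianProductWith : ∀ {A B C : Set} (f : A → B → C) xs ys →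
  length (cartesianProductWith f xs ys) ≡ length xs * length ys
length-cartesianProductWith f []       ys = refl
length-cartesianProductWith f (x ∷ xs) ys =
  trans (length-++ (map (f x) ys))
        (cong₂ ℕ._+_ (length-map (f x) ys) (length-cartesianProductWith f xs ys))

length-vectors : ∀ {A : Set} (xs : List A) k → length (vectors xs k) ≡ length xs ^ k
length-vectors xs zero    = refl
length-vectors xs (suc k) =
  trans (length-cartesianProductWith _∷_ xs (vectors xs k))
        (cong (length xs *_) (length-vectors xs k))

-- The number `k` of rows is kept apart from their length `n`: full tables have `k = n`, tables
-- without their first row one less.
length-vectors² : ∀ n k → length (vectors (vectors (allFin n) n) k) ≡ (n ^ n) ^ k
length-vectors² n k = trans (length-vectors (vectors (allFin n) n) k) (cong (_^ k) (begin
  length (vectors (allFin n) n)  ≡⟨ length-vectors (allFin n) n ⟩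
  length (allFin n) ^ n          ≡⟨ cong (_^ n) (length-tabulate {n = n} (λ i → i)) ⟩
  n ^ n                          ∎))
  where open ≡-Reasoning

tail-injective : ∀ {m} {s t : Table (suc m)} → IsQuasigroup s → IsQuasigroup t →
                 tail s ≡ tail t → s ≡ t
tail-injective {s = r ∷ u} {r′ ∷ .u} (_ , s-columns) (_ , t-columns) refl =
  cong (_∷ u) (Pointwise-≡⇒≡ (ext r≗r′))
  where
  -- The column of r′ ∷ u through y attains the entry of r at y; by uniqueness
  -- in the column of r ∷ u it cannot do so within the common rows u.
  r≗r′ : ∀ y → Vec.lookup r y ≡ Vec.lookup r′ y
  r≗r′ y with t-columns y (Vec.lookup r y) | s-columns y (Vec.lookup r y)
  ... | zero  , eq , _ | _            = sym eq
  ... | suc x , eq , _ | _ , _ , uniq = contradiction (trans (sym (uniq {zero} refl)) (uniq {suc x} eq)) λ ()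

-- Stated for a variable n: at n = suc m, checking the body would unfold the
-- filter that defines #quasigroups, which is very slow.
#quasigroups≤length : ∀ n {B : Set} (f : Table n → B) →
  (∀ {s t} → IsQuasigroup s → IsQuasigroup t → f s ≡ f t → s ≡ t) →
  ∀ {ys} → (∀ y → y ∈ ys) → #quasigroups n ≤ length ys
#quasigroups≤length n f = length-filter-injective isQuasigroup? f (tables-unique n)

#quasigroups≤ : ∀ m → #quasigroups (suc m) ≤ (suc m ^ suc m) ^ m
#quasigroups≤ m = ≤-trans
  (#quasigroups≤length (suc m) tail tail-injective
    (vectors-complete (vectors-complete ∈-allFin)))
  (≤-reflexive (length-vectors² (suc m) m))

n!≤n^n : ∀ n → n ! ≤ n ^ n
n!≤n^n zero    = ≤-refl
-- Both sides unfold to a multiple of `suc n`, which leaves `n ! ≤ suc n ^ n`.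
n!≤n^n (suc n) = *-monoʳ-≤ (suc n) (begin
  n !        ≤⟨ n!≤n^n n ⟩
  n ^ n      ≤⟨ ^-monoˡ-≤ n (n≤1+n n) ⟩
  suc n ^ n  ∎)
  where open ≤-Reasoning

#quasigroups*n!<n*#magmas : ∀ {n} → 2 ≤ n → #quasigroups n * n ! ℕ.< n * #magmas n
#quasigroups*n!<n*#magmas {n@(suc m)} 2≤n = begin-strict
  #quasigroups n * n !   ≤⟨ *-mono-≤ (#quasigroups≤ m) (n!≤n^n n) ⟩
  (n ^ n) ^ m * n ^ n    ≡⟨ *-comm ((n ^ n) ^ m) (n ^ n) ⟩
  -- The bound `n ^ n` on `n !` stands in for the choices of the dropped row: with `n = suc m` the
  -- power unfolds to `n ^ n * (n ^ n) ^ m`.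
  (n ^ n) ^ n            ≡⟨ length-vectors² n n ⟨
  #magmas n              <⟨ m<m*n (#magmas n) n {{#magmas≢0 n}} 2≤n ⟩
  #magmas n * n          ≡⟨ *-comm (#magmas n) n ⟩
  n * #magmas n          ∎
  where open ≤-Reasoning

-- Since `_/_` reduces to lowest terms, cross-multiplication is done on the unreduced fractions, to
-- which both sides are equivalent as unnormalised rationals.
/-mono-< : ∀ a b c d .{{_ : NonZero b}} .{{_ : NonZero d}} →
           a * d ℕ.< c * b → + a / b < + c / d
/-mono-< a b@(suc b-1) c d@(suc d-1) ad<cb =
  toℚᵘ-cancel-<
    (<-respˡ-≃ (≃-sym (toℚᵘ-fromℚᵘ (mkℚᵘ (+ a) b-1)))
    (<-respʳ-≃ (≃-sym (toℚᵘ-fromℚᵘ (mkℚᵘ (+ c) d-1)))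
    (*<* (subst₂ ℤ._<_ (ℤ.pos-* a d) (ℤ.pos-* c b) (ℤ.+<+ ad<cb)))))

theorem1p3 : ∃ λ (N : ℕ) → ∀ n → N ≤ n →
    quasigroupProportion n < (+ n / n !) {{n !≢0}}
-- The least possible threshold: at `n = 1` both sides equal 1.
theorem1p3 = 2 , λ n 2≤n →
  /-mono-< (#quasigroups n) (#magmas n) n (n !) {{#magmas≢0 n}} {{n !≢0}} (#quasigroups*n!<n*#magmas 2≤n)
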